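{- The consequence relation $ss \cap tt$ has a unique truth-functional binary connective $\to$ satisfying the single-conclusion version of the conclusion-Gentzen regularity rule (i.e.\ the deduction theorem): for all sets of formulae $\Gamma$ and formulae $A,B$, $\Gamma \vdash A \to B$ iff $\Gamma, A\vdash B$. It is the connective whose truth-function is given by $x \to y = 1$ if $x \leq y$, and $x \to y = y$ otherwise; that is, $1\to 1 = 1$, $1\to \tfrac{1}{2} = \tfrac{1}{2}$, $1 \to 0 = 0$, $\tfrac{1}{2}\to 1 = 1$, $\tfrac{1}{2}\to\tfrac{1}{2} = 1$, $\tfrac{1}{2}\to 0 = 0$, and $0 \to y = 1$ for every $y$ (a three-valued Gödel implication). However, $ss \cap tt$ has no truth-functional connective $\to$ satisfying the single-conclusion version of the premise-Gentzen regularity rule: for all $\Gamma, A, B$, $\Gamma, A\to B\vdash$ (empty conclusion) iff ($\Gamma, B \vdash$ and $\Gamma \vdash A$). The Gödel conditional just defined does, however, satisfy the right-to-left direction of that premise rule: if $\Gamma, B \vdash$ and $\Gamma \vdash A$, then $\Gamma, A\to B\vdash$.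
   Context: Three-valued truth-functional semantics with truth values $\{0, \tfrac{1}{2}, 1\}$ ordered $0 < \tfrac{1}{2} < 1$, over a sentential language whose semantics is constant expressive (for each truth value there is a formula taking that value under every valuation), and where consequence relates sets of premises to sets of conclusions (possibly empty). The relation $ss \cap tt$ is the intersection of the pure consequence relation $ss$ (preservation of the value $1$: whenever all premises take value $1$, some conclusion takes value $1$) and the pure consequence relation $tt$ (preservation of non-zero values: whenever all premises take a value in $\{1,\tfrac{1}{2}\}$, some conclusion does). Equivalently, $\Gamma \vdash \Delta$ iff for every valuation $v$: some premise value is $\leq$ some conclusion value, or some premise has value $0$, or some conclusion has value $1$. -}

module Defs where

open import Level using (0ℓ)
open import Data.Bool.Base using (if_then_else_)
open import Data.Maybe.Base using (Maybe; just; nothing)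
open import Data.Nat.Base as ℕ using (ℕ)
import Data.Nat.Properties as ℕ
open import Data.Product.Base using (_×_; ∃-syntax)
open import Data.Sum.Base using (_⊎_)
open import Data.Vec.Base using (Vec; []; _∷_)
open import Function.Bundles using (_⇔_)
open import Relation.Binary.PropositionalEquality.Core using (_≡_; refl)
open import Relation.Nullary.Decidable.Core using (Dec; ⌊_⌋)
open import Relation.Unary using (Pred; _∈_; _∪_; ｛_｝; ∅)

data Value : Set where
  𝟎 ½ 𝟏 : Value

rank : Value → ℕ
rank 𝟎 = 0
rank ½ = 1
rank 𝟏 = 2

infix 4 _≤_ _≤?_

_≤_ : Value → Value → Set
x ≤ y = rank x ℕ.≤ rank y

_≤?_ : ∀ x y → Dec (x ≤ y)
x ≤? y = rank x ℕ.≤? rank y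

BinaryTruthFunction : Set
BinaryTruthFunction = Value → Value → Value

infix 4 _≐_

_≐_ : BinaryTruthFunction → BinaryTruthFunction → Set
f ≐ g = ∀ x y → f x y ≡ g x y

gödel : BinaryTruthFunction
gödel x y = if ⌊ x ≤? y ⌋ then 𝟏 else y

gödelTable : BinaryTruthFunction
gödelTable 𝟏 𝟏 = 𝟏
gödelTable 𝟏 ½ = ½
gödelTable 𝟏 𝟎 = 𝟎
gödelTable ½ 𝟏 = 𝟏
gödelTable ½ ½ = 𝟏
gödelTable ½ 𝟎 = 𝟎
gödelTable 𝟎 _ = 𝟏

record Language : Set₁ where
  field
    Atom   : Set
    Symbol : Set
    arity  : Symbol → ℕ
    interp : (s : Symbol) → Vec Value (arity s) → Value

  data Formula : Set where
    atom : Atom → Formula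
    conn : (s : Symbol) → Vec Formula (arity s) → Formula

  Valuation : Set
  Valuation = Atom → Value

  eval  : Valuation → Formula → Value
  evals : ∀ {n} → Valuation → Vec Formula n → Vec Value n

  eval v (atom p)    = v p
  eval v (conn s As) = interp s (evals v As)

  evals v []       = []
  evals v (A ∷ As) = eval v A ∷ evals v As

open Language public using (Formula; Valuation; eval)

ConstantExpressive : Language → Set
ConstantExpressive L =
  (x : Value) → ∃[ A ] ((v : Valuation L) → eval L v A ≡ x)

Strict : Pred Value 0ℓ
Strict x = x ≡ 𝟏

Tolerant : Pred Value 0ℓ
Tolerant x = x ≡ 𝟏 ⊎ x ≡ ½

Preserves : Pred Value 0ℓ → (L : Language) →
            Pred (Formula L) 0ℓ → Pred (Formula L) 0ℓ → Set
Preserves D L Γ Δ =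
  (v : Valuation L) →
  (∀ A → A ∈ Γ → D (eval L v A)) →
  ∃[ B ] (B ∈ Δ × D (eval L v B))

ss tt ss∩tt : (L : Language) →
              Pred (Formula L) 0ℓ → Pred (Formula L) 0ℓ → Set
ss            = Preserves Strict
tt            = Preserves Tolerant
ss∩tt L Γ Δ = ss L Γ Δ × tt L Γ Δ

-- A binary operation on formulas, primitive or defined, whose value is a
-- function of the values of its arguments.
record TruthFunctionalBinary (L : Language) : Set where
  field
    apply         : Formula L → Formula L → Formula L
    truthFunction : BinaryTruthFunction
    eval-apply    : ∀ v A B →
                    eval L v (apply A B) ≡ truthFunction (eval L v A) (eval L v B)

open TruthFunctionalBinary public using (truthFunction)

-- The language with one further primitive binary symbol, `nothing`,
-- interpreted by f.
_⊕_ : Language → BinaryTruthFunction → Language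
L ⊕ f = record
  { Atom   = Atom
  ; Symbol = Maybe Symbol
  ; arity  = arity⁺
  ; interp = interp⁺
  }
  where
  open Language L using (Atom; Symbol; arity; interp)

  arity⁺ : Maybe Symbol → ℕ
  arity⁺ (just s) = arity s
  arity⁺ nothing  = 2

  interp⁺ : (s : Maybe Symbol) → Vec Value (arity⁺ s) → Value
  interp⁺ (just s) xs           = interp s xs
  interp⁺ nothing  (x ∷ y ∷ []) = f x y

fresh : (L : Language) (f : BinaryTruthFunction) → TruthFunctionalBinary (L ⊕ f)
fresh L f = record
  { apply         = λ A B → Language.conn nothing (A ∷ B ∷ [])
  ; truthFunction = f
  ; eval-apply    = λ v A B → refl
  }

module _ {L : Language} (c : TruthFunctionalBinary L) where

  open TruthFunctionalBinary c using () renaming (apply to infixr 6 _⇒_)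

  private
    infix 3 _⊢_
    _⊢_ : Pred (Formula L) 0ℓ → Pred (Formula L) 0ℓ → Set
    _⊢_ = ss∩tt L

  ConclusionGentzenRule : Set₁
  ConclusionGentzenRule = ∀ (Γ : Pred (Formula L) 0ℓ) A B →
    (Γ ⊢ ｛ A ⇒ B ｝) ⇔ (Γ ∪ ｛ A ｝ ⊢ ｛ B ｝)

  PremiseGentzenRule : Set₁
  PremiseGentzenRule = ∀ (Γ : Pred (Formula L) 0ℓ) A B →
    (Γ ∪ ｛ A ⇒ B ｝ ⊢ ∅) ⇔ ((Γ ∪ ｛ B ｝ ⊢ ∅) × (Γ ⊢ ｛ A ｝))

  PremiseGentzenRule⇐ : Set₁
  PremiseGentzenRule⇐ = ∀ (Γ : Pred (Formula L) 0ℓ) A B →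
    (Γ ∪ ｛ B ｝ ⊢ ∅) × (Γ ⊢ ｛ A ｝) → Γ ∪ ｛ A ⇒ B ｝ ⊢ ∅

{-# OPTIONS --safe #-}
-- On formulas of constant value the sequents of ss ∩ tt compare the infimum of
-- the premises with the supremum of the conclusions.  The conclusion-Gentzen
-- rule thus says z ≤ x → y ⇔ z ⊓ x ≤ y, so → can only be the residuum of ⊓,
-- which is gödel.  The premise-Gentzen rule likewise says
-- z ⊓ (x → y) ≤ 𝟎 ⇔ (z ⊓ y ≤ 𝟎 and z ≤ x); at x = ½, y = 𝟎 the choice z = ½
-- forces ½ → 𝟎 = 𝟎, and then z = 𝟏 gives 𝟏 ≤ ½.
module Submission where

open import Defs
open import Level using (0ℓ)
open import Data.Maybe.Base using (just)
open import Data.Nat.Base using (z≤n; s≤s)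
import Data.Nat.Properties as ℕ
open import Data.Product using (_×_; ∃!; ∃-syntax; _,_; proj₁; proj₂)
open import Data.Sum.Base using (inj₁; inj₂)
open import Data.Vec.Base using (Vec; []; _∷_)
open import Function.Base using (_∘_)
open import Function.Bundles using (_⇔_; mk⇔; Equivalence)
open import Relation.Binary.Definitions using (DecidableEquality)
open import Relation.Binary.PropositionalEquality using (_≡_; refl; sym; trans; cong; cong₂; subst)
open import Relation.Nullary.Decidable using (Dec; map′; from-yes; ¬?; _×-dec_; _⊎-dec_; _→-dec_)
open import Relation.Nullary.Negation.Core using (¬_; contradiction)
open import Relation.Unary using (Pred; Decidable; _∈_; _∪_; ｛_｝; ∅)

open Equivalence using (to; from)

-- Decidable facts about the three-valued chain

rank-injective : ∀ {x y} → rank x ≡ rank y → x ≡ y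
rank-injective {𝟎} {𝟎} refl = refl
rank-injective {½} {½} refl = refl
rank-injective {𝟏} {𝟏} refl = refl

_≟_ : DecidableEquality Value
x ≟ y = map′ rank-injective (cong rank) (rank x ℕ.≟ rank y)

-- Reduces each truth-table fact below to a finite check that `from-yes` settles by evaluation.
every? : {P : Pred Value 0ℓ} → Decidable P → Dec (∀ x → P x)
every? P? = map′ (λ { (p₀ , p½ , p₁) → λ { 𝟎 → p₀ ; ½ → p½ ; 𝟏 → p₁ } })
                 (λ p → p 𝟎 , p ½ , p 𝟏)
                 (P? 𝟎 ×-dec P? ½ ×-dec P? 𝟏)

strict? : Decidable Strict
strict? x = x ≟ 𝟏

tolerant? : Decidable Tolerant
tolerant? x = (x ≟ 𝟏) ⊎-dec (x ≟ ½)

infixr 7 _⊓_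

_⊓_ : Value → Value → Value
𝟎 ⊓ y = 𝟎
½ ⊓ 𝟎 = 𝟎
½ ⊓ ½ = ½
½ ⊓ 𝟏 = ½
𝟏 ⊓ y = y

≤⇒preserved : ∀ x y → x ≤ y → (Strict x → Strict y) × (Tolerant x → Tolerant y)
≤⇒preserved = from-yes (every? λ x → every? λ y →
  (x ≤? y) →-dec ((strict? x →-dec strict? y) ×-dec (tolerant? x →-dec tolerant? y)))

-- `Strict` and `Tolerant` are the nonempty proper up-sets of the chain, so whenever `y` lies
-- strictly below `x`, one of them contains `x` but not `y`.
preserved⇒≤ : ∀ x y → (Strict x → Strict y) × (Tolerant x → Tolerant y) → x ≤ y
preserved⇒≤ = from-yes (every? λ x → every? λ y →
  ((strict? x →-dec strict? y) ×-dec (tolerant? x →-dec tolerant? y)) →-dec (x ≤? y))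

IsResiduum : BinaryTruthFunction → Set
IsResiduum f = ∀ x y z → (z ≤ f x y → z ⊓ x ≤ y) × (z ⊓ x ≤ y → z ≤ f x y)

residuum-unique : ∀ {f} → IsResiduum f → f ≐ gödel
residuum-unique {f} res x y = determined x y (f x y) (res x y)
  where
  -- Replacing `f x y` by an arbitrary value `w` turns a claim about functions into one about
  -- finitely many values: `w` must be the greatest `z` with `z ⊓ x ≤ y`.
  determined : ∀ x y w → (∀ z → (z ≤ w → z ⊓ x ≤ y) × (z ⊓ x ≤ y → z ≤ w)) →
               w ≡ gödel x y
  determined = from-yes (every? λ x → every? λ y → every? λ w →
    every? (λ z → ((z ≤? w) →-dec (z ⊓ x ≤? y)) ×-dec ((z ⊓ x ≤? y) →-dec (z ≤? w)))
    →-dec (w ≟ gödel x y))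

gödel≐gödelTable : gödel ≐ gödelTable
gödel≐gödelTable = from-yes (every? λ x → every? λ y → gödel x y ≟ gödelTable x y)

-- What the strict and the tolerant values share, so that one argument serves both standards.
-- `⊓-projects` amounts to upward closure.
record ProperFilter (D : Pred Value 0ℓ) : Set where
  field
    proper       : ¬ D 𝟎
    ⊓-closed     : ∀ x y → D x × D y → D (x ⊓ y)
    ⊓-projects   : ∀ x y → D (x ⊓ y) → D x × D y
    modusPonens  : ∀ x y → D x → D (gödel x y) → D y

open ProperFilter

properFilter? : ∀ {D} → Decidable D → Dec (ProperFilter D)
properFilter? D? = map′
  (λ (p , c , π , m) → record { proper = p ; ⊓-closed = c ; ⊓-projects = π ; modusPonens = m })
  (λ F → proper F , ⊓-closed F , ⊓-projects F , modusPonens F)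
  (¬? (D? 𝟎)
   ×-dec every? (λ x → every? λ y → (D? x ×-dec D? y) →-dec D? (x ⊓ y))
   ×-dec every? (λ x → every? λ y → D? (x ⊓ y) →-dec (D? x ×-dec D? y))
   ×-dec every? (λ x → every? λ y → D? x →-dec (D? (gödel x y) →-dec D? y)))

strictFilter : ProperFilter Strict
strictFilter = from-yes (properFilter? strict?)

tolerantFilter : ProperFilter Tolerant
tolerantFilter = from-yes (properFilter? tolerant?)

-- Both hypotheses together give `x ≤ y`. Strict preservation alone would admit `x = ½`, `y = 𝟎`,
-- where `gödel` yields `𝟎`.
gödel-strict : ∀ x y → (Strict x → Strict y) × (Tolerant x → Tolerant y) → Strict (gödel x y)
gödel-strict = from-yes (every? λ x → every? λ y →
  ((strict? x →-dec strict? y) ×-dec (tolerant? x →-dec tolerant? y)) →-dec strict? (gödel x y))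

gödel-tolerant : ∀ x y → (Tolerant x → Tolerant y) → Tolerant (gödel x y)
gödel-tolerant = from-yes (every? λ x → every? λ y →
  (tolerant? x →-dec tolerant? y) →-dec tolerant? (gödel x y))

-- Sequents as inequalities

module _ {L : Language} where

  HasValue : Formula L → Value → Set
  HasValue A x = ∀ v → eval L v A ≡ x

  -- Bounds are expressed through filter membership, the form in which `Preserves` uses them, and
  -- must be the same under every valuation.
  HasInfimum HasSupremum : Pred (Formula L) 0ℓ → Value → Set₁
  HasInfimum Γ x = ∀ {D} → ProperFilter D → ∀ v →
    (∀ A → A ∈ Γ → D (eval L v A)) ⇔ D x
  HasSupremum Δ x = ∀ {D} → ProperFilter D → ∀ v →
    (∃[ B ] (B ∈ Δ × D (eval L v B))) ⇔ D x

  infimum-｛｝ : ∀ {A x} → HasValue A x → HasInfimum ｛ A ｝ x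
  infimum-｛｝ A≡x {D} _ v = mk⇔
    (λ all → subst D (A≡x v) (all _ refl))
    (λ { d _ refl → subst D (sym (A≡x v)) d })

  infimum-∪ : ∀ {Γ Γ′ x y} → HasInfimum Γ x → HasInfimum Γ′ y →
              HasInfimum (Γ ∪ Γ′) (x ⊓ y)
  infimum-∪ {x = x} {y} inf inf′ F v = mk⇔
    (λ all → ⊓-closed F x y ( to (inf F v) (λ A → all A ∘ inj₁)
                            , to (inf′ F v) (λ A → all A ∘ inj₂)))
    (λ d → λ { A (inj₁ A∈Γ)  → from (inf F v) (proj₁ (⊓-projects F x y d)) A A∈Γ
             ; A (inj₂ A∈Γ′) → from (inf′ F v) (proj₂ (⊓-projects F x y d)) A A∈Γ′ })

  supremum-｛｝ : ∀ {A x} → HasValue A x → HasSupremum ｛ A ｝ x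
  supremum-｛｝ A≡x {D} _ v = mk⇔
    (λ { (_ , refl , d) → subst D (A≡x v) d })
    (λ d → _ , refl , subst D (sym (A≡x v)) d)

  supremum-∅ : HasSupremum ∅ 𝟎
  supremum-∅ F v = mk⇔ (λ ()) (λ d → contradiction d (proper F))

  ss∩tt⇔≤ : ∀ {Γ Δ x y} → HasInfimum Γ x → HasSupremum Δ y → ss∩tt L Γ Δ ⇔ x ≤ y
  ss∩tt⇔≤ {Γ} {Δ} {x} {y} inf sup = mk⇔
    (λ (s , t) → preserved⇒≤ x y (reflect strictFilter s , reflect tolerantFilter t))
    (λ x≤y → let s , t = ≤⇒preserved x y x≤y in lift strictFilter s , lift tolerantFilter t)
    where
    reflect : ∀ {D} → ProperFilter D → Preserves D L Γ Δ → D x → D y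
    reflect F p = to (sup F v₀) ∘ p v₀ ∘ from (inf F v₀)
      where
      v₀ : Valuation L
      -- Any valuation would do, since neither bound depends on it.
      v₀ _ = 𝟎
    lift : ∀ {D} → ProperFilter D → (D x → D y) → Preserves D L Γ Δ
    lift F p v = from (sup F v) ∘ p ∘ to (inf F v)

  extend : ∀ (D : Pred Value 0ℓ) {v} {Γ : Pred (Formula L) 0ℓ} {A} →
           (∀ C → C ∈ Γ → D (eval L v C)) → D (eval L v A) →
           ∀ C → C ∈ Γ ∪ ｛ A ｝ → D (eval L v C)
  extend D all d C (inj₁ C∈Γ)  = all C C∈Γ
  extend D all d _ (inj₂ refl) = d

-- What the Gentzen rules force on a truth function

module _ {L : Language} (const : ConstantExpressive L) (c : TruthFunctionalBinary L) where

  open TruthFunctionalBinary c using (eval-apply) renaming (apply to infixr 6 _⇒_)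

  private
    f = truthFunction c

    ⌜_⌝ : Value → Formula L
    ⌜ x ⌝ = proj₁ (const x)

    ⌜⌝-value : ∀ x → HasValue ⌜ x ⌝ x
    ⌜⌝-value x = proj₂ (const x)

    ⇒-value : ∀ x y → HasValue (⌜ x ⌝ ⇒ ⌜ y ⌝) (f x y)
    ⇒-value x y v = trans (eval-apply v _ _) (cong₂ f (⌜⌝-value x v) (⌜⌝-value y v))

    infimum-pair : ∀ z {A x} → HasValue A x → HasInfimum (｛ ⌜ z ⌝ ｝ ∪ ｛ A ｝) (z ⊓ x)
    infimum-pair z A≡x = infimum-∪ (infimum-｛｝ (⌜⌝-value z)) (infimum-｛｝ A≡x)

  conclusionGentzen⇒residuum : ConclusionGentzenRule c → IsResiduum f
  conclusionGentzen⇒residuum rule x y z =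
    to right ∘ to sequents ∘ from left , to left ∘ from sequents ∘ from right
    where
    -- A single constant premise as context already realises any prescribed infimum `z`.
    sequents = rule ｛ ⌜ z ⌝ ｝ ⌜ x ⌝ ⌜ y ⌝
    left  = ss∩tt⇔≤ (infimum-｛｝ (⌜⌝-value z)) (supremum-｛｝ (⇒-value x y))
    right = ss∩tt⇔≤ (infimum-pair z (⌜⌝-value x)) (supremum-｛｝ (⌜⌝-value y))

  conclusionGentzen⇒gödel : ConclusionGentzenRule c → f ≐ gödel
  conclusionGentzen⇒gödel = residuum-unique ∘ conclusionGentzen⇒residuum

  premiseGentzen⇔ : PremiseGentzenRule c → ∀ x y z →
                    z ⊓ f x y ≤ 𝟎 ⇔ (z ⊓ y ≤ 𝟎 × z ≤ x)
  premiseGentzen⇔ rule x y z = mk⇔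
    (λ l → let b , a = to sequents (from left l) in to refuteB b , to proveA a)
    (λ (b , a) → to left (from sequents (from refuteB b , from proveA a)))
    where
    sequents = rule ｛ ⌜ z ⌝ ｝ ⌜ x ⌝ ⌜ y ⌝
    left    = ss∩tt⇔≤ (infimum-pair z (⇒-value x y)) supremum-∅
    refuteB = ss∩tt⇔≤ (infimum-pair z (⌜⌝-value y)) supremum-∅
    proveA  = ss∩tt⇔≤ (infimum-｛｝ (⌜⌝-value z)) (supremum-｛｝ (⌜⌝-value x))

  ¬premiseGentzen : ¬ PremiseGentzenRule c
  ¬premiseGentzen rule = impossible (proj₂ (to (premiseGentzen⇔ rule ½ 𝟎 𝟏) f½𝟎≤𝟎))
    where
    -- A chain has no zero divisors for `⊓`: either inequality says that `w` is `𝟎`.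
    ½⊓-reflects : ∀ w → ½ ⊓ w ≤ 𝟎 → 𝟏 ⊓ w ≤ 𝟎
    ½⊓-reflects = from-yes (every? λ w → (½ ⊓ w ≤? 𝟎) →-dec (𝟏 ⊓ w ≤? 𝟎))
    f½𝟎≤𝟎 : 𝟏 ⊓ f ½ 𝟎 ≤ 𝟎
    f½𝟎≤𝟎 = ½⊓-reflects (f ½ 𝟎) (from (premiseGentzen⇔ rule ½ 𝟎 ½) (z≤n , s≤s z≤n))
    impossible : ¬ 𝟏 ≤ ½
    impossible (s≤s ())

-- Rules satisfied by the Gödel conditional

module _ {L : Language} (c : TruthFunctionalBinary L) (f≐gödel : truthFunction c ≐ gödel) where

  open TruthFunctionalBinary c using (eval-apply) renaming (apply to infixr 6 _⇒_)

  private
    ⇒-gödel : ∀ v A B → eval L v (A ⇒ B) ≡ gödel (eval L v A) (eval L v B)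
    ⇒-gödel v A B = trans (eval-apply v A B) (f≐gödel _ _)

    detach : ∀ {D} → ProperFilter D → ∀ v A B →
             D (eval L v A) → D (eval L v (A ⇒ B)) → D (eval L v B)
    detach {D} F v A B a ab = modusPonens F _ _ a (subst D (⇒-gödel v A B) ab)

  gödel⇒conclusionGentzen : ConclusionGentzenRule c
  gödel⇒conclusionGentzen Γ A B = mk⇔
    (λ (s , t) → elim strictFilter s , elim tolerantFilter t)
    (λ (s , t) →
      (λ v all → _ , refl , subst Strict (sym (⇒-gödel v A B)) (gödel-strict (eval L v A) (eval L v B)
        ( discharge Strict s v all
        -- The strict half also draws on the tolerant half of the sequent, which applies because
        -- premises of value `𝟏` are tolerant.
        , discharge Tolerant t v (λ C → inj₁ ∘ all C)))) ,
      (λ v all → _ , refl , subst Tolerant (sym (⇒-gödel v A B)) (gödel-tolerant (eval L v A) (eval L v B)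
        (discharge Tolerant t v all))))
    where
    elim : ∀ {D} → ProperFilter D → Preserves D L Γ ｛ A ⇒ B ｝ →
           Preserves D L (Γ ∪ ｛ A ｝) ｛ B ｝
    elim F p v all with p v (λ C → all C ∘ inj₁)
    ... | _ , refl , ab = B , refl , detach F v A B (all A (inj₂ refl)) ab

    discharge : ∀ D → Preserves D L (Γ ∪ ｛ A ｝) ｛ B ｝ → ∀ v →
                (∀ C → C ∈ Γ → D (eval L v C)) → D (eval L v A) → D (eval L v B)
    discharge D p v all a with p v (extend D all a)
    ... | _ , refl , b = b

  -- Within each filter, `Γ` yields `A`, detachment yields `B`, and `Γ` with `B` is refuted.
  gödel⇒premiseGentzen⇐ : PremiseGentzenRule⇐ c
  gödel⇒premiseGentzen⇐ Γ A B ((sB , tB) , (sA , tA)) =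
    refute strictFilter sB sA , refute tolerantFilter tB tA
    where
    refute : ∀ {D} → ProperFilter D → Preserves D L (Γ ∪ ｛ B ｝) ∅ →
             Preserves D L Γ ｛ A ｝ → Preserves D L (Γ ∪ ｛ A ⇒ B ｝) ∅
    refute {D} F pB pA v all with pA v (λ C → all C ∘ inj₁)
    ... | _ , refl , a =
      pB v (extend D (λ C → all C ∘ inj₁) (detach F v A B a (all _ (inj₂ refl))))

-- Constants survive the addition of a connective

module _ (L : Language) (f : BinaryTruthFunction) where

  embed  : Formula L → Formula (L ⊕ f)
  embeds : ∀ {n} → Vec (Formula L) n → Vec (Formula (L ⊕ f)) n
  embed (Language.atom p)    = Language.atom p
  embed (Language.conn s As) = Language.conn (just s) (embeds As)
  embeds []       = []
  embeds (A ∷ As) = embed A ∷ embeds As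

  eval-embed  : ∀ v A → eval (L ⊕ f) v (embed A) ≡ eval L v A
  evals-embed : ∀ {n} v (As : Vec (Formula L) n) →
                Language.evals (L ⊕ f) v (embeds As) ≡ Language.evals L v As
  eval-embed v (Language.atom p)    = refl
  eval-embed v (Language.conn s As) = cong (Language.interp L s) (evals-embed v As)
  evals-embed v []       = refl
  evals-embed v (A ∷ As) = cong₂ _∷_ (eval-embed v A) (evals-embed v As)

  ⊕-constantExpressive : ConstantExpressive L → ConstantExpressive (L ⊕ f)
  ⊕-constantExpressive const x =
    let A , A≡x = const x in embed A , λ v → trans (eval-embed v A) (A≡x v)

theorem4p2 : (L : Language) → ConstantExpressive L →
    ∃! _≐_ (λ f → ConclusionGentzenRule (fresh L f))
    × (∀ f → ConclusionGentzenRule (fresh L f) → f ≐ gödel)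
    × (∀ (c : TruthFunctionalBinary L) →
    ConclusionGentzenRule c ⇔ (truthFunction c ≐ gödel))
    × (gödel ≐ gödelTable)
    × (∀ (c : TruthFunctionalBinary L) → ¬ PremiseGentzenRule c)
    × (∀ (c : TruthFunctionalBinary L) →
    truthFunction c ≐ gödel → PremiseGentzenRule⇐ c)
theorem4p2 L const =
  ( gödel
  , gödel⇒conclusionGentzen (fresh L gödel) (λ _ _ → refl)
  , λ {f} rule x y → sym (freshUnique f rule x y))
  , freshUnique
  , (λ c → mk⇔ (conclusionGentzen⇒gödel const c) (gödel⇒conclusionGentzen c))
  , gödel≐gödelTable
  , ¬premiseGentzen const
  , gödel⇒premiseGentzen⇐
  where
  freshUnique : ∀ f → ConclusionGentzenRule (fresh L f) → f ≐ gödel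
  -- Each candidate `f` lives in its own language `L ⊕ f`, so the constants are carried over
  -- separately for each.
  freshUnique f = conclusionGentzen⇒gödel (⊕-constantExpressive L f const) (fresh L f)
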